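{- Let $V(\mathbf 0)$ be the Voronoi cell at the origin of the lattice $A_n$. For every integer $k$ with $2\le k\le n-1$, every $k$-dimensional face of $V(\mathbf 0)$ is a hyper-rhombus.
   Context: Let $\mathbf 1=(1,\dots,1)^T\in\mathbb R^{n+1}$ and $H=\{x\in\mathbb R^{n+1}:x\cdot\mathbf 1=0\}$. The lattice $A_n$ is $\mathbb Z^{n+1}\cap H$. Its Voronoi cell at the origin, taken inside $H$, is $V(\mathbf 0)=\{x\in H:\|x\|\le\|x-q\|\text{ for all }q\in A_n\}$, an $n$-dimensional convex polytope. An $m$-dimensional hyper-rhombus is defined recursively: for $m=2$ it is a rhombus; for $m\ge3$ it is a parallelepiped all of whose $(m-1)$-dimensional faces are congruent $(m-1)$-dimensional hyper-rhombi. Congruent means related by an isometry. -}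

module Defs where

open import Algebra.Bundles using (CommutativeRing)
open import Data.Fin.Base using (Fin; zero; suc)
open import Data.Integer.Base using (ℤ; +_; -[1+_])
open import Data.Nat.Base as ℕ using (ℕ)
open import Data.Product.Base using (∃; ∃₂; _×_; _,_; proj₁; proj₂)
open import Data.Sum.Base using (inj₁; inj₂)
open import Data.Vec.Functional using (Vector; zipWith; replicate)
open import Function.Bundles using (_⇔_)
open import Level using (0ℓ)
open import Relation.Binary.Core using (Rel)
open import Relation.Binary.Structures using (IsDecTotalOrder)
open import Relation.Nullary using (¬_; contradiction)
open import Relation.Nullary.Decidable using (decidable-stable)
open import Relation.Unary using (Pred; _∈_; _∩_; _≐_)

-- The real numbers, axiomatised as a complete ordered field.  Decidability
-- of the order is the usual classical trichotomy.
record CompleteOrderedField : Set₁ where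
  field
    commutativeRing : CommutativeRing 0ℓ 0ℓ

  open CommutativeRing commutativeRing public

  infix 4 _≤_
  field
    _≤_             : Rel Carrier 0ℓ
    isDecTotalOrder : IsDecTotalOrder _≈_ _≤_

  UpperBound : Pred Carrier 0ℓ → Pred Carrier 0ℓ
  UpperBound S u = ∀ {x} → x ∈ S → x ≤ u

  field
    0≉1        : ¬ (0# ≈ 1#)
    inverse    : ∀ x → ¬ (x ≈ 0#) → ∃ λ y → x * y ≈ 1#
    +-monoʳ-≤  : ∀ z {x y} → x ≤ y → z + x ≤ z + y
    *-nonneg   : ∀ {x y} → 0# ≤ x → 0# ≤ y → 0# ≤ x * y
    completion : ∀ (S : Pred Carrier 0ℓ) → ∃ S → ∃ (UpperBound S) →
                 ∃ λ s → UpperBound S s × (∀ u → UpperBound S u → s ≤ u)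

  open IsDecTotalOrder isDecTotalOrder public
    using (_≤?_; _≟_; total; antisym; ≤-respˡ-≈; ≤-respʳ-≈; ≤-resp-≈)
    renaming (refl to ≤-refl; reflexive to ≤-reflexive; trans to ≤-trans)

-- Square roots of nonnegative reals, constructed from completeness.
module SquareRoot (ℝ : CompleteOrderedField) where
  open CompleteOrderedField ℝ
  open import Algebra.Properties.Ring ring
    using (-‿distribˡ-*; -‿distribʳ-*; -‿involutive)
  open import Algebra.Properties.CommutativeSemigroup +-commutativeSemigroup
    using (x∙yz≈y∙xz)

  +-mono-≤ : ∀ {w x y z} → w ≤ x → y ≤ z → w + y ≤ x + z
  +-mono-≤ {w} {x} {y} {z} p q = ≤-trans (+-monoʳ-≤ w q)
    (≤-respˡ-≈ (+-comm z w) (≤-respʳ-≈ (+-comm z x) (+-monoʳ-≤ z p)))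

  x≤x+y : ∀ {x y} → 0# ≤ y → x ≤ x + y
  x≤x+y {x} p = ≤-respˡ-≈ (+-identityʳ x) (+-monoʳ-≤ x p)

  x+[y-x]≈y : ∀ x y → x + (y - x) ≈ y
  x+[y-x]≈y x y =
    trans (x∙yz≈y∙xz x y (- x)) (trans (+-congˡ (-‿inverseʳ x)) (+-identityʳ y))

  +-cancelˡ-≤ : ∀ z {x y} → z + x ≤ z + y → x ≤ y
  +-cancelˡ-≤ z {x} {y} p = ≤-respˡ-≈ (lemma x) (≤-respʳ-≈ (lemma y) (+-monoʳ-≤ (- z) p))
    where
    lemma : ∀ x → - z + (z + x) ≈ x
    lemma x = trans (sym (+-assoc (- z) z x)) (trans (+-congʳ (-‿inverseˡ z)) (+-identityˡ x))

  x≤y⇒0≤y-x : ∀ {x y} → x ≤ y → 0# ≤ y - x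
  x≤y⇒0≤y-x {x} {y} p = +-cancelˡ-≤ x
    (≤-respˡ-≈ (sym (+-identityʳ x)) (≤-respʳ-≈ (sym (x+[y-x]≈y x y)) p))

  0≤y-x⇒x≤y : ∀ {x y} → 0# ≤ y - x → x ≤ y
  0≤y-x⇒x≤y {x} {y} p = ≤-respʳ-≈ (x+[y-x]≈y x y) (x≤x+y p)

  x≤0⇒0≤-x : ∀ {x} → x ≤ 0# → 0# ≤ - x
  x≤0⇒0≤-x {x} p = ≤-respʳ-≈ (+-identityˡ (- x)) (x≤y⇒0≤y-x p)

  ≰⇒≥ : ∀ {x y} → ¬ (x ≤ y) → y ≤ x
  ≰⇒≥ {x} {y} x≰y with total x y
  ... | inj₁ x≤y = contradiction x≤y x≰y
  ... | inj₂ y≤x = y≤x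

  *-monoʳ-≤ : ∀ {z x y} → 0# ≤ z → x ≤ y → z * x ≤ z * y
  *-monoʳ-≤ {z} {x} {y} 0≤z x≤y = 0≤y-x⇒x≤y
    (≤-respʳ-≈ (trans (distribˡ z y (- x)) (+-congˡ (sym (-‿distribʳ-* z x))))
      (*-nonneg 0≤z (x≤y⇒0≤y-x x≤y)))

  *-mono-≤ : ∀ {w x y z} → 0# ≤ w → w ≤ x → 0# ≤ y → y ≤ z → w * y ≤ x * z
  *-mono-≤ {w} {x} {y} {z} 0≤w w≤x 0≤y y≤z = ≤-trans (*-monoʳ-≤ 0≤w y≤z)
    (≤-respˡ-≈ (*-comm z w) (≤-respʳ-≈ (*-comm z x) (*-monoʳ-≤ (≤-trans 0≤y y≤z) w≤x)))

  0≤x*x : ∀ x → 0# ≤ x * x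
  0≤x*x x with total 0# x
  ... | inj₁ 0≤x = *-nonneg 0≤x 0≤x
  ... | inj₂ x≤0 = ≤-respʳ-≈ -x*-x≈x*x (*-nonneg (x≤0⇒0≤-x x≤0) (x≤0⇒0≤-x x≤0))
    where
    -x*-x≈x*x : - x * - x ≈ x * x
    -x*-x≈x*x = trans (sym (-‿distribˡ-* x (- x)))
      (trans (-‿cong (sym (-‿distribʳ-* x x))) (-‿involutive (x * x)))

  0≤1 : 0# ≤ 1#
  0≤1 = ≤-respʳ-≈ (*-identityˡ 1#) (0≤x*x 1#)

  1≰0 : ¬ (1# ≤ 0#)
  1≰0 1≤0 = 0≉1 (antisym 0≤1 1≤0)

  positive-inverse : ∀ {c y} → 0# ≤ c → c * y ≈ 1# → ¬ (y ≤ 0#)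
  positive-inverse {c} {y} 0≤c cy≈1 y≤0 =
    1≰0 (≤-respˡ-≈ cy≈1 (≤-respʳ-≈ (zeroʳ c) (*-monoʳ-≤ 0≤c y≤0)))

  positive-* : ∀ {x y} → ¬ (x ≤ 0#) → ¬ (y ≤ 0#) → ¬ (x * y ≤ 0#)
  positive-* {x} {y} x>0 y>0 xy≤0 = y>0 (≤-reflexive y≈0)
    where
    x⁻¹ = inverse x (λ x≈0 → x>0 (≤-reflexive x≈0))
    z = proj₁ x⁻¹
    xy≈0 : x * y ≈ 0#
    xy≈0 = antisym xy≤0 (*-nonneg (≰⇒≥ x>0) (≰⇒≥ y>0))
    y≈0 : y ≈ 0#
    y≈0 = trans (sym (*-identityˡ y)) (trans (*-congʳ (trans (sym (proj₂ x⁻¹)) (*-comm x z)))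
      (trans (*-assoc z x y) (trans (*-congˡ xy≈0) (zeroʳ z))))

  square-+ : ∀ s e → (s + e) * (s + e) ≈ s * s + e * (s + s + e)
  square-+ s e = trans (distribʳ (s + e) s e) (trans (+-congʳ (distribˡ s s e))
    (trans (+-assoc (s * s) (s * e) (e * (s + e))) (+-congˡ
      (trans (+-congʳ (*-comm s e))
        (trans (sym (distribˡ e s (s + e))) (*-congˡ (sym (+-assoc s s e))))))))

  small : ∀ s d → 0# ≤ s → ¬ (d ≤ 0#) →
          ∃ λ e → ¬ (e ≤ 0#) × ¬ (d ≤ e * (s + s + e))
  small s d 0≤s d>0 = e , e>0 , e[2s+e]<d
    where
    b = s + s + 1#
    c = b + d
    0≤d = ≰⇒≥ d>0
    0≤2s : 0# ≤ s + s
    0≤2s = ≤-trans 0≤s (x≤x+y 0≤s)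
    0≤b : 0# ≤ b
    0≤b = ≤-trans 0≤2s (x≤x+y 0≤1)
    0≤c : 0# ≤ c
    0≤c = ≤-trans 0≤b (x≤x+y 0≤d)
    d≤c : d ≤ c
    d≤c = ≤-respʳ-≈ (+-comm d b) (x≤x+y 0≤b)
    c≉0 : ¬ (c ≈ 0#)
    c≉0 c≈0 = d>0 (≤-respʳ-≈ c≈0 d≤c)
    c⁻¹ = inverse c c≉0
    y = proj₁ c⁻¹
    cy≈1 = proj₂ c⁻¹
    y>0 = positive-inverse 0≤c cy≈1
    e = y * d
    e>0 : ¬ (e ≤ 0#)
    e>0 = positive-* y>0 d>0
    0≤e = ≰⇒≥ e>0
    e≤1 : e ≤ 1#
    e≤1 = ≤-respʳ-≈ (trans (*-comm y c) cy≈1) (*-monoʳ-≤ (≰⇒≥ y>0) d≤c)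
    eb+ed≈d : e * b + e * d ≈ d
    eb+ed≈d = trans (sym (distribˡ e b d)) (trans (*-comm e c)
      (trans (sym (*-assoc c y d)) (trans (*-congʳ cy≈1) (*-identityˡ d))))
    e[2s+e]<d : ¬ (d ≤ e * (s + s + e))
    e[2s+e]<d p = positive-* e>0 d>0 (+-cancelˡ-≤ (e * b)
      (≤-respˡ-≈ (sym eb+ed≈d) (≤-respʳ-≈ (sym (+-identityʳ (e * b)))
        (≤-trans p (*-monoʳ-≤ 0≤e (+-monoʳ-≤ (s + s) e≤1))))))

  ≤-stable : ∀ {x y} → ¬ ¬ (x ≤ y) → x ≤ y
  ≤-stable {x} {y} = decidable-stable (x ≤? y)

  gap : ∀ {x y} → ¬ (x ≤ y) → ¬ (x - y ≤ 0#)
  gap {x} {y} x≰y p = x≰y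
    (≤-respˡ-≈ (x+[y-x]≈y y x) (≤-respʳ-≈ (+-identityʳ y) (+-monoʳ-≤ y p)))

  Below : Carrier → Pred Carrier 0ℓ
  Below a t = 0# ≤ t × t * t ≤ a

  0∈Below : ∀ {a} → 0# ≤ a → 0# ∈ Below a
  0∈Below 0≤a = ≤-refl , ≤-respˡ-≈ (sym (zeroˡ 0#)) 0≤a

  Below-bounded : ∀ {a} → 0# ≤ a → UpperBound (Below a) (a + 1#)
  Below-bounded {a} 0≤a {t} (0≤t , t²≤a) = ≤-stable λ t≰a+1 →
    let a+1≤t = ≰⇒≥ t≰a+1
        1≤t   = ≤-trans (≤-respʳ-≈ (+-comm 1# a) (x≤x+y 0≤a)) a+1≤t
        t≤a   = ≤-trans (≤-respˡ-≈ (*-identityʳ t) (*-monoʳ-≤ 0≤t 1≤t)) t²≤a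
    in 1≰0 (+-cancelˡ-≤ a (≤-respʳ-≈ (sym (+-identityʳ a)) (≤-trans a+1≤t t≤a)))

  a≤s*s : ∀ {a s} → 0# ≤ s → UpperBound (Below a) s → a ≤ s * s
  a≤s*s {a} {s} 0≤s upper = ≤-stable λ a≰s² → no-step (small s (a - s * s) 0≤s (gap a≰s²))
    where
    no-step : ¬ (∃ λ e → ¬ (e ≤ 0#) × ¬ (a - s * s ≤ e * (s + s + e)))
    no-step (e , e>0 , step) = e>0
      (+-cancelˡ-≤ s (≤-respʳ-≈ (sym (+-identityʳ s)) (upper (0≤s+e , [s+e]²≤a))))
      where
      0≤s+e : 0# ≤ s + e
      0≤s+e = ≤-trans 0≤s (x≤x+y (≰⇒≥ e>0))
      [s+e]²≤a : (s + e) * (s + e) ≤ a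
      [s+e]²≤a = ≤-respˡ-≈ (sym (square-+ s e)) (≤-respʳ-≈ (x+[y-x]≈y (s * s) a)
        (+-monoʳ-≤ (s * s) (≰⇒≥ step)))

  s*s≤a : ∀ {a s} → 0# ≤ s → UpperBound (Below a) s →
          (∀ u → UpperBound (Below a) u → s ≤ u) → s * s ≤ a
  s*s≤a {a} {s} 0≤s upper least = ≤-stable λ s²≰a → no-step (small s (s * s - a) 0≤s (gap s²≰a))
    where
    no-step : ¬ (∃ λ e → ¬ (e ≤ 0#) × ¬ (s * s - a ≤ e * (s + s + e)))
    no-step (e , e>0 , step) = e>0
      (+-cancelˡ-≤ s (≤-respʳ-≈ (sym (+-identityʳ s)) (≤-respˡ-≈ (+-comm e s)
        (≤-respʳ-≈ (x+[y-x]≈y e s) (+-monoʳ-≤ e (least (s - e) upper′))))))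
      where
      upper′ : UpperBound (Below a) (s - e)
      upper′ {t} (0≤t , t²≤a) = ≤-stable λ t≰s-e →
        let t≤s   = upper (0≤t , t²≤a)
            s≤t+e = ≤-respˡ-≈ (x+[y-x]≈y e s) (≤-respʳ-≈ (+-comm e t) (+-monoʳ-≤ e (≰⇒≥ t≰s-e)))
            s²≤a+e[2s+e] = ≤-trans (*-mono-≤ 0≤s s≤t+e 0≤s s≤t+e)
              (≤-respˡ-≈ (sym (square-+ t e)) (+-mono-≤ t²≤a
                (*-monoʳ-≤ (≰⇒≥ e>0) (+-mono-≤ (+-mono-≤ t≤s t≤s) ≤-refl))))
        in step (+-cancelˡ-≤ a (≤-respˡ-≈ (sym (x+[y-x]≈y a (s * s))) s²≤a+e[2s+e]))

  √-exists : ∀ a → 0# ≤ a → ∃ λ s → 0# ≤ s × s * s ≈ a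
  √-exists a 0≤a = fromSupremum
    (completion (Below a) (0# , 0∈Below 0≤a) (a + 1# , Below-bounded 0≤a))
    where
    fromSupremum : (∃ λ s → UpperBound (Below a) s × (∀ u → UpperBound (Below a) u → s ≤ u)) →
                   ∃ λ s → 0# ≤ s × s * s ≈ a
    fromSupremum (s , upper , least) =
      s , 0≤s , antisym (s*s≤a 0≤s upper least) (a≤s*s 0≤s upper)
      where
      0≤s : 0# ≤ s
      0≤s = upper (0∈Below 0≤a)

  √ : ∀ a → 0# ≤ a → Carrier
  √ a 0≤a = proj₁ (√-exists a 0≤a)

module Euclidean (ℝ : CompleteOrderedField) where
  open CompleteOrderedField ℝ hiding (zero)
  open SquareRoot ℝ using (√; +-mono-≤; 0≤x*x)
  open import Algebra.Properties.Semiring.Sum semiring using (sum)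
  open import Algebra.Properties.Monoid.Mult +-monoid using ()
    renaming (_×_ to _×ℕ_)
  open import Data.Vec.Functional.Relation.Binary.Equality.Setoid setoid
    using (_≋_)

  Point : ℕ → Set
  Point N = Vector Carrier N

  Subset : ℕ → Set₁
  Subset N = Pred (Point N) 0ℓ

  infixl 6 _⊕_ _⊖_
  infixr 7 _⊙_

  _⊕_ _⊖_ : ∀ {N} → Point N → Point N → Point N
  _⊕_ = zipWith _+_
  _⊖_ = zipWith _-_

  _⊙_ : ∀ {N} → Carrier → Point N → Point N
  (t ⊙ x) i = t * x i

  𝟎 𝟏 : ∀ {N} → Point N
  𝟎 = replicate _ 0#
  𝟏 = replicate _ 1#

  ⟨_,_⟩ : ∀ {N} → Point N → Point N → Carrier
  ⟨ x , y ⟩ = sum (λ i → x i * y i)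

  ⟨x,x⟩-nonneg : ∀ {N} (x : Point N) → 0# ≤ ⟨ x , x ⟩
  ⟨x,x⟩-nonneg {ℕ.zero}  x = ≤-refl
  ⟨x,x⟩-nonneg {ℕ.suc N} x = ≤-respˡ-≈ (+-identityˡ 0#)
    (+-mono-≤ (0≤x*x (x zero)) (⟨x,x⟩-nonneg (λ i → x (suc i))))

  ‖_‖ : ∀ {N} → Point N → Carrier
  ‖ x ‖ = √ ⟨ x , x ⟩ (⟨x,x⟩-nonneg x)

  combination : ∀ {N m} → (Fin m → Carrier) → (Fin m → Point N) → Point N
  combination t v j = sum (λ i → t i * v i j)

  LinearlyIndependent : ∀ {N m} → (Fin m → Point N) → Set
  LinearlyIndependent v = ∀ t → combination t v ≋ 𝟎 → ∀ i → t i ≈ 0#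

  -- The points p , p ⊕ v 0 , … , p ⊕ v (m - 1) of F are affinely independent
  -- and their affine hull contains F.
  HasDimension : ∀ {N} → ℕ → Subset N → Set
  HasDimension {N} m F =
    ∃₂ λ (p : Point N) (v : Fin m → Point N) →
      p ∈ F × (∀ i → p ⊕ v i ∈ F) × LinearlyIndependent v ×
      (∀ {x} → x ∈ F → ∃ λ t → x ≋ p ⊕ combination t v)

  -- Faces of a convex set P are its intersections with {x | ⟨ c , x ⟩ = b},
  -- for ⟨ c , x ⟩ ≤ b a valid inequality on P.  Allowing c = 0 makes P itself
  -- and the empty set faces.
  IsFace : ∀ {N} → Subset N → Subset N → Set
  IsFace F P = ∃₂ λ c b →
    (∀ {x} → x ∈ P → ⟨ c , x ⟩ ≤ b) ×
    (F ≐ (λ x → x ∈ P × ⟨ c , x ⟩ ≈ b))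

  IsIsometry : ∀ {N} → (Point N → Point N) → Set
  IsIsometry φ = ∀ x y → ‖ φ x ⊖ φ y ‖ ≈ ‖ x ⊖ y ‖

  -- The second component says that φ maps F onto G.
  Congruent : ∀ {N} → Subset N → Subset N → Set
  Congruent F G = ∃ λ φ → IsIsometry φ ×
    (∀ y → y ∈ G ⇔ (∃ λ x → x ∈ F × φ x ≋ y))

  box : ∀ {N m} → Point N → (Fin m → Point N) → Subset N
  box p v x = ∃ λ t → (∀ i → 0# ≤ t i × t i ≤ 1#) × x ≋ p ⊕ combination t v

  IsParallelepiped : ∀ {N} → ℕ → Subset N → Set
  IsParallelepiped {N} m P =
    ∃₂ λ (p : Point N) (v : Fin m → Point N) →
      LinearlyIndependent v × (P ≐ box p v)

  -- Each side of the parallelogram is a translate of one of its two edge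
  -- vectors, so equal edge lengths mean that all four sides are equal.
  IsRhombus : ∀ {N} → Subset N → Set
  IsRhombus {N} P =
    ∃₂ λ (p : Point N) (v : Fin 2 → Point N) →
      LinearlyIndependent v × (P ≐ box p v) × ‖ v zero ‖ ≈ ‖ v (suc zero) ‖

  data IsHyperRhombus {N : ℕ} : ℕ → Subset N → Set₁ where
    rhombus : ∀ {P} → IsRhombus P → IsHyperRhombus 2 P
    higher  : ∀ {m P} → 3 ℕ.≤ ℕ.suc m →
              IsParallelepiped (ℕ.suc m) P →
              (∀ F → IsFace F P → HasDimension m F → IsHyperRhombus m F) →
              (∀ F G → IsFace F P → HasDimension m F →
                       IsFace G P → HasDimension m G → Congruent F G) →
              IsHyperRhombus (ℕ.suc m) P

  fromℤ : ℤ → Carrier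
  fromℤ (+ n)    = n ×ℕ 1#
  fromℤ -[1+ n ] = - (ℕ.suc n ×ℕ 1#)

  ℤ^ : ∀ N → Subset N
  ℤ^ N x = ∀ i → ∃ λ z → x i ≈ fromℤ z

  H : ∀ n → Subset (ℕ.suc n)
  H n x = ⟨ x , 𝟏 ⟩ ≈ 0#

  A : ∀ n → Subset (ℕ.suc n)
  A n = ℤ^ (ℕ.suc n) ∩ H n

  VoronoiCell : ∀ n → Subset (ℕ.suc n)
  VoronoiCell n x = x ∈ H n × (∀ q → q ∈ A n → ‖ x ‖ ≤ ‖ x ⊖ q ‖)

-- Let w i be the orthogonal projection of the i-th basis vector onto H.  The
-- Voronoi cell is the projection of the cube [0, 1]^(n+1), that is, the set of
-- all combinations of the w i with coefficients in [0, 1].  On such a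
-- generalised box a linear functional c is maximal where the coefficient of
-- w i is 1 if ⟨ c , w i ⟩ > 0, is 0 if ⟨ c , w i ⟩ < 0, and is free otherwise;
-- hence every face is again a box spanned by some of the w i.  A face using all
-- of them has dimension n.  Any proper subfamily of the w i is linearly
-- independent, so every other face is a parallelepiped, and so are its own
-- faces.  Coordinate permutations permute the w i: they show that the edges
-- have equal length and that faces of equal dimension are congruent.

module Submission where

open import Defs
open import Algebra.Bundles using (CommutativeRing; RawRing)
open import Data.Bool.Base using (true; false; if_then_else_)
open import Data.Fin.Base as Fin using (Fin; zero; suc; punchIn)
open import Data.Fin.Permutation as Perm using (Permutation′; _⟨$⟩ʳ_; _⟨$⟩ˡ_)
open import Data.Fin.Properties as Fin
  using (any?; all?; ¬∀⟶∃¬; punchInᵢ≢i; lift-injective; suc-injective)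
open import Data.Integer.Base using (+_; -[1+_])
open import Data.Maybe.Base using (Maybe; just; nothing)
open import Data.Nat.Base as ℕ using (ℕ; suc; _∸_; z≤n; s≤s; s≤s⁻¹) renaming (_≤_ to _≤ℕ_)
open import Data.Nat.Properties as ℕ using (≰⇒>)
open import Data.Product.Base using (∃; ∃₂; _×_; _,_; proj₁; proj₂)
open import Data.Sum.Base using (inj₁; inj₂)
open import Data.Vec.Functional as Vector using (insertAt; removeAt)
open import Data.Vec.Functional.Properties using (insertAt-lookup; insertAt-punchIn)
open import Function.Base using (_∘_; id)
open import Function.Bundles using (mk⇔; Injection)
open import Function.Definitions using (Injective)
open import Function.Properties.Inverse using (↔⇒↣)
open import Level using (0ℓ)
open import Relation.Binary.PropositionalEquality as ≡ using (_≡_; _≢_)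
open import Relation.Nullary using (¬_; yes; no; does; contradiction; ¬?)
open import Relation.Nullary.Decidable using (dec-true; dec-false)
open import Relation.Unary using (Pred; _∈_; _⊆_; _≐_)

-- A ring solver with integer coefficients.

-- Over an abstract carrier the standard ring solver cancels terms only if its
-- coefficients come from a concrete ring with decidable equality.
module DifferenceSolver (R : CommutativeRing 0ℓ 0ℓ) where
  open CommutativeRing R
  open import Algebra.Properties.AbelianGroup +-abelianGroup
    using (⁻¹-∙-comm; ⁻¹-anti-homo-//; //-rightDividesʳ; ε⁻¹≈ε)
  open import Algebra.Properties.CommutativeSemigroup +-commutativeSemigroup
    using (interchange)
  open import Algebra.Properties.Ring ring
    using (-‿distribˡ-*; -‿distribʳ-*)
  open import Algebra.Properties.Semiring.Mult semiring
    using (×-homo-+; ×1-homo-*; ×-congˡ) renaming (_×_ to _×ℕ_)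
  open import Algebra.Solver.Ring.AlmostCommutativeRing
    using (fromCommutativeRing; _-Raw-AlmostCommutative⟶_)
  open import Relation.Binary.Reasoning.Setoid setoid

  -- A pair (a , b) stands for the integer a − b.
  differences : RawRing 0ℓ 0ℓ
  differences = record
    { Carrier = ℕ × ℕ
    ; _≈_     = _≡_
    ; _+_     = λ (a , b) (c , d) → a ℕ.+ c , b ℕ.+ d
    ; _*_     = λ (a , b) (c , d) → a ℕ.* c ℕ.+ b ℕ.* d , a ℕ.* d ℕ.+ b ℕ.* c
    ; -_      = λ (a , b) → b , a
    ; 0#      = 0 , 0
    ; 1#      = 1 , 0
    }

  value : ℕ × ℕ → Carrier
  value (a , b) = a ×ℕ 1# - b ×ℕ 1#

  -- The first two clauses let the constants of the solver reduce to 0# and 1#.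
  ⟦_⟧ : ℕ × ℕ → Carrier
  ⟦ 0 , 0 ⟧ = 0#
  ⟦ 1 , 0 ⟧ = 1#
  ⟦ p ⟧     = value p

  ⟦⟧≈value : ∀ p → ⟦ p ⟧ ≈ value p
  ⟦⟧≈value (0 , 0)           = sym (-‿inverseʳ 0#)
  ⟦⟧≈value (1 , 0)           = sym (trans (+-cong (+-identityʳ 1#) ε⁻¹≈ε) (+-identityʳ 1#))
  ⟦⟧≈value (0 , suc b)       = refl
  ⟦⟧≈value (1 , suc b)       = refl
  ⟦⟧≈value (suc (suc a) , b) = refl

  sub-interchange : ∀ w x y z → (w + x) - (y + z) ≈ (w - y) + (x - z)
  sub-interchange w x y z =
    trans (+-congˡ (sym (⁻¹-∙-comm y z))) (interchange w x (- y) (- z))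

  value-* : ∀ p q → value (RawRing._*_ differences p q) ≈ value p * value q
  value-* (a , b) (c , d) = begin
    (a ℕ.* c ℕ.+ b ℕ.* d) ×ℕ 1# - (a ℕ.* d ℕ.+ b ℕ.* c) ×ℕ 1#
      ≈⟨ +-cong (×-homo-+ 1# (a ℕ.* c) (b ℕ.* d)) (-‿cong (×-homo-+ 1# (a ℕ.* d) (b ℕ.* c))) ⟩
    ((a ℕ.* c) ×ℕ 1# + (b ℕ.* d) ×ℕ 1#) - ((a ℕ.* d) ×ℕ 1# + (b ℕ.* c) ×ℕ 1#)
      ≈⟨ +-cong (+-cong (×1-homo-* a c) (×1-homo-* b d))
           (-‿cong (+-cong (×1-homo-* a d) (×1-homo-* b c))) ⟩
    (A * C + B * D) - (A * D + B * C)
      ≈⟨ sub-interchange (A * C) (B * D) (A * D) (B * C) ⟩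
    (A * C - A * D) + (B * D - B * C)
      ≈⟨ +-cong (+-congˡ (-‿distribʳ-* A D)) (sym (⁻¹-anti-homo-// (B * C) (B * D))) ⟩
    (A * C + A * - D) + - (B * C - B * D)
      ≈⟨ +-cong (sym (distribˡ A C (- D)))
           (-‿cong (trans (+-congˡ (-‿distribʳ-* B D)) (sym (distribˡ B C (- D))))) ⟩
    A * (C - D) + - (B * (C - D))
      ≈⟨ +-congˡ (-‿distribˡ-* B (C - D)) ⟩
    A * (C - D) + - B * (C - D)
      ≈⟨ distribʳ (C - D) A (- B) ⟨
    (A - B) * (C - D) ∎
    where
    A = a ×ℕ 1#
    B = b ×ℕ 1#
    C = c ×ℕ 1#
    D = d ×ℕ 1#

  morphism : differences -Raw-AlmostCommutative⟶ fromCommutativeRing R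
  morphism = record
    { ⟦_⟧    = ⟦_⟧
    ; +-homo = λ p@(a , b) q@(c , d) → trans (⟦⟧≈value (a ℕ.+ c , b ℕ.+ d)) (trans
        (trans (+-cong (×-homo-+ 1# a c) (-‿cong (×-homo-+ 1# b d))) (sub-interchange _ _ _ _))
        (+-cong (sym (⟦⟧≈value p)) (sym (⟦⟧≈value q))))
    ; *-homo = λ p q → trans (⟦⟧≈value (RawRing._*_ differences p q))
        (trans (value-* p q) (*-cong (sym (⟦⟧≈value p)) (sym (⟦⟧≈value q))))
    ; -‿homo = λ p@(a , b) → trans (⟦⟧≈value (b , a))
        (trans (sym (⁻¹-anti-homo-// (a ×ℕ 1#) (b ×ℕ 1#))) (-‿cong (sym (⟦⟧≈value p))))
    ; 0-homo = refl
    ; 1-homo = refl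
    }

  -- Cross-addition reduces an equality of differences to one of natural numbers, which `equal?` can
  -- decide; adding and then subtracting `D` and `B` carries it over to the ring.
  cross-sum : ∀ a b c d → a ℕ.+ d ≡ c ℕ.+ b → value (a , b) ≈ value (c , d)
  cross-sum a b c d eq = begin
    A - B               ≈⟨ //-rightDividesʳ D (A - B) ⟨
    ((A - B) + D) - D   ≈⟨ +-congʳ (begin
      (A - B) + D         ≈⟨ +-assoc A (- B) D ⟩
      A + (- B + D)       ≈⟨ +-congˡ (+-comm (- B) D) ⟩
      A + (D - B)         ≈⟨ +-assoc A D (- B) ⟨
      (A + D) - B         ≈⟨ +-congʳ (sym (×-homo-+ 1# a d)) ⟩
      (a ℕ.+ d) ×ℕ 1# - B ≈⟨ +-congʳ (×-congˡ eq) ⟩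
      (c ℕ.+ b) ×ℕ 1# - B ≈⟨ +-congʳ (×-homo-+ 1# c b) ⟩
      (C + B) - B         ≈⟨ //-rightDividesʳ B C ⟩
      C                   ∎) ⟩
    C - D ∎
    where
    A = a ×ℕ 1#
    B = b ×ℕ 1#
    C = c ×ℕ 1#
    D = d ×ℕ 1#

  equal? : ∀ p q → Maybe (⟦ p ⟧ ≈ ⟦ q ⟧)
  equal? (a , b) (c , d) with (a ℕ.+ d) ℕ.≟ (c ℕ.+ b)
  ... | yes eq = just (trans (⟦⟧≈value (a , b))
                     (trans (cross-sum a b c d eq) (sym (⟦⟧≈value (c , d)))))
  ... | no _   = nothing

  open import Algebra.Solver.Ring differences (fromCommutativeRing R) morphism equal? public
    using (solve; con; _:=_; _:+_; _:*_; _:-_; :-_)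

module Rhombohedra (ℝ : CompleteOrderedField) where
  open CompleteOrderedField ℝ hiding (zero)
  open SquareRoot ℝ
  open Euclidean ℝ
  open DifferenceSolver commutativeRing
  open import Algebra.Properties.Semiring.Sum semiring
  open import Algebra.Properties.Semiring.Mult semiring
    using (×-assoc-*; ×-congʳ) renaming (_×_ to _×ℕ_)
  open import Data.Vec.Functional.Relation.Binary.Equality.Setoid setoid
    using (_≋_; ≋-refl; ≋-sym; ≋-trans)
  open import Relation.Binary.Reasoning.Setoid setoid

  -- Finite sums and linear combinations.

  sum-zero : ∀ {n} (f : Fin n → Carrier) → (∀ i → f i ≈ 0#) → sum f ≈ 0#
  sum-zero {n} f f≈0 = trans (sum-cong-≋ f≈0) (sum-replicate-zero n)

  sum-single : ∀ {n} (f : Fin n → Carrier) j → (∀ i → i ≢ j → f i ≈ 0#) → sum f ≈ f j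
  sum-single {suc n} f j f≈0 = begin
    sum f                    ≈⟨ sum-remove {i = j} f ⟩
    f j + sum (removeAt f j) ≈⟨ +-congˡ (sum-zero _ (λ i → f≈0 (punchIn j i) (punchInᵢ≢i j i))) ⟩
    f j + 0#                 ≈⟨ +-identityʳ (f j) ⟩
    f j                      ∎

  sum-neg : ∀ {n} (f : Fin n → Carrier) → sum (λ i → - f i) ≈ - sum f
  sum-neg {ℕ.zero} f = solve 0 (con (0 , 0) := :- con (0 , 0)) refl
  sum-neg {suc n}  f = trans (+-congˡ (sum-neg (f ∘ suc)))
    (solve 2 (λ a b → :- a :+ :- b := :- (a :+ b)) refl (f zero) (sum (f ∘ suc)))

  sum-mono : ∀ {n} (f g : Fin n → Carrier) → (∀ i → f i ≤ g i) → sum f ≤ sum g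
  sum-mono {ℕ.zero} f g f≤g = ≤-refl
  sum-mono {suc n}  f g f≤g = +-mono-≤ (f≤g zero) (sum-mono (f ∘ suc) (g ∘ suc) (f≤g ∘ suc))

  δ : ∀ {n} → Fin n → Fin n → Carrier
  δ i j = if does (i Fin.≟ j) then 1# else 0#

  δ-diagonal : ∀ {n} (i : Fin n) → δ i i ≈ 1#
  δ-diagonal i rewrite dec-true (i Fin.≟ i) ≡.refl = refl

  δ-offDiagonal : ∀ {n} {i j : Fin n} → i ≢ j → δ i j ≈ 0#
  δ-offDiagonal {i = i} {j} i≢j rewrite dec-false (i Fin.≟ j) i≢j = refl

  sum-δʳ : ∀ {n} (t : Fin n → Carrier) j → sum (λ i → δ j i * t i) ≈ t j
  sum-δʳ t j = trans
    (sum-single _ j (λ i i≢j → trans (*-congʳ (δ-offDiagonal (i≢j ∘ ≡.sym))) (zeroˡ _)))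
    (trans (*-congʳ (δ-diagonal j)) (*-identityˡ _))

  *-zeroProduct : ∀ {x y} → ¬ (x ≈ 0#) → x * y ≈ 0# → y ≈ 0#
  *-zeroProduct {x} {y} x≉0 xy≈0 = begin
    y           ≈⟨ *-identityˡ y ⟨
    1# * y      ≈⟨ *-congʳ (trans (*-comm z x) (proj₂ (inverse x x≉0))) ⟨
    z * x * y   ≈⟨ *-assoc z x y ⟩
    z * (x * y) ≈⟨ *-congˡ xy≈0 ⟩
    z * 0#      ≈⟨ zeroʳ z ⟩
    0#          ∎
    where z = proj₁ (inverse x x≉0)

  combination-δ : ∀ {N m} (v : Fin m → Point N) i → combination (δ i) v ≋ v i
  combination-δ v i j = sum-δʳ (λ l → v l j) i

  combination-⊖ : ∀ {N m} (s t : Fin m → Carrier) (v : Fin m → Point N) →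
                  combination (λ i → s i - t i) v ≋ combination s v ⊖ combination t v
  combination-⊖ s t v j = begin
    sum (λ i → (s i - t i) * v i j)
      ≈⟨ sum-cong-≋ (λ i → solve 3 (λ a b c → (a :- b) :* c := a :* c :+ :- (b :* c)) refl
           (s i) (t i) (v i j)) ⟩
    sum (λ i → s i * v i j + - (t i * v i j))
      ≈⟨ ∑-distrib-+ (λ i → s i * v i j) (λ i → - (t i * v i j)) ⟩
    combination s v j + sum (λ i → - (t i * v i j))
      ≈⟨ +-congˡ (sum-neg (λ i → t i * v i j)) ⟩
    combination s v j - combination t v j ∎

  combination-combination : ∀ {N k m} (t : Fin k → Carrier) (a : Fin k → Fin m → Carrier)
                            (v : Fin m → Point N) →
                            combination t (λ i → combination (a i) v) ≋ combination (combination t a) v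
  combination-combination t a v j = begin
    sum (λ i → t i * sum (λ l → a i l * v l j))
      ≈⟨ sum-cong-≋ (λ i → *-distribˡ-sum (t i) (λ l → a i l * v l j)) ⟩
    sum (λ i → sum (λ l → t i * (a i l * v l j)))
      ≈⟨ ∑-comm (λ i l → t i * (a i l * v l j)) ⟩
    sum (λ l → sum (λ i → t i * (a i l * v l j)))
      ≈⟨ sum-cong-≋ (λ l → trans (sum-cong-≋ (λ i → sym (*-assoc (t i) (a i l) (v l j))))
           (sym (*-distribʳ-sum (v l j) (λ i → t i * a i l)))) ⟩
    sum (λ l → sum (λ i → t i * a i l) * v l j) ∎

  -- Linear dependence and bounds on dimension.

  -- Gaussian elimination: a pivot in the first column removes one equation
  -- and one unknown.
  dependence : ∀ {m k} → m ℕ.< k → (a : Fin k → Point m) →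
               ∃ λ t → combination t a ≋ 𝟎 × ∃ λ i → ¬ (t i ≈ 0#)
  dependence {ℕ.zero} {suc k} _ a = (λ _ → 1#) , (λ ()) , zero , λ 1≈0 → 0≉1 (sym 1≈0)
  dependence {suc m} {suc k} m<k a with all? (λ i → a i zero ≟ 0#)
  ... | yes column≈0 = t , t-solves , nonzero
    where
    tail-dependence = dependence (ℕ.<-trans (ℕ.n<1+n m) m<k) (λ i j → a i (suc j))
    t       = proj₁ tail-dependence
    nonzero = proj₂ (proj₂ tail-dependence)
    t-solves : combination t a ≋ 𝟎
    t-solves zero    = sum-zero _ (λ i → trans (*-congˡ (column≈0 i)) (zeroʳ (t i)))
    t-solves (suc j) = proj₁ (proj₂ tail-dependence) j
  ... | no column≉0 = t , t-solves , punchIn r i , λ tᵢ≈0 →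
        s-nonzero (*-zeroProduct pivot≉0 (trans (*-comm pivot (s i))
          (trans (reflexive (≡.sym (insertAt-punchIn (λ l → s l * pivot) r t-r i))) tᵢ≈0)))
    where
    pivotRow = ¬∀⟶∃¬ (suc k) _ (λ i → a i zero ≟ 0#) column≉0
    r        = proj₁ pivotRow
    pivot    = a r zero
    pivot≉0  = proj₂ pivotRow
    -- Each remaining row is scaled by the pivot before the multiple of row `r` that clears its
    -- first entry is subtracted; this avoids dividing by the pivot.
    b : Fin k → Point m
    b i j = pivot * a (punchIn r i) (suc j) - a (punchIn r i) zero * a r (suc j)
    b-dependence = dependence (s≤s⁻¹ m<k) b
    s            = proj₁ b-dependence
    i            = proj₁ (proj₂ (proj₂ b-dependence))
    s-nonzero    = proj₂ (proj₂ (proj₂ b-dependence))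
    -- The coefficient of the pivot row is chosen so that the first column cancels.
    t-r = - sum (λ i → s i * a (punchIn r i) zero)
    t : Fin (suc k) → Carrier
    t = insertAt (λ i → s i * pivot) r t-r
    expand : ∀ j → combination t a j ≈ t-r * a r j + sum (λ i → s i * pivot * a (punchIn r i) j)
    expand j = trans (sum-remove {i = r} (λ i → t i * a i j)) (+-cong
      (*-congʳ (reflexive (insertAt-lookup (λ l → s l * pivot) r t-r)))
      (sum-cong-≋ (λ i → *-congʳ (reflexive (insertAt-punchIn (λ l → s l * pivot) r t-r i)))))
    t-solves : combination t a ≋ 𝟎
    t-solves zero = trans (expand zero) (begin
      t-r * pivot + sum (λ i → s i * pivot * a (punchIn r i) zero)
        ≈⟨ +-congˡ (sum-cong-≋ (λ i → solve 3 (λ x y z → x :* y :* z := x :* z :* y) refl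
             (s i) pivot (a (punchIn r i) zero))) ⟩
      t-r * pivot + sum (λ i → s i * a (punchIn r i) zero * pivot)
        ≈⟨ +-congˡ (sym (*-distribʳ-sum pivot (λ i → s i * a (punchIn r i) zero))) ⟩
      t-r * pivot + sum (λ i → s i * a (punchIn r i) zero) * pivot
        ≈⟨ solve 2 (λ x y → :- x :* y :+ x :* y := con (0 , 0)) refl
             (sum (λ i → s i * a (punchIn r i) zero)) pivot ⟩
      0# ∎)
    t-solves (suc j) = trans (expand (suc j)) (begin
      - S * c + sum (λ i → s i * pivot * a (punchIn r i) (suc j))
        ≈⟨ +-congˡ (sum-cong-≋ (λ i → solve 5 (λ x y z u v → x :* y :* z := x :* (y :* z :- u :* v) :+ x :* u :* v) refl
             (s i) pivot (a (punchIn r i) (suc j)) (a (punchIn r i) zero) c)) ⟩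
      - S * c + sum (λ i → s i * b i j + s i * a (punchIn r i) zero * c)
        ≈⟨ +-congˡ (∑-distrib-+ (λ i → s i * b i j) (λ i → s i * a (punchIn r i) zero * c)) ⟩
      - S * c + (combination s b j + sum (λ i → s i * a (punchIn r i) zero * c))
        ≈⟨ +-congˡ (+-cong (proj₁ (proj₂ b-dependence) j) (sym (*-distribʳ-sum c (λ i → s i * a (punchIn r i) zero)))) ⟩
      - S * c + (0# + S * c)
        ≈⟨ solve 2 (λ x y → :- x :* y :+ (con (0 , 0) :+ x :* y) := con (0 , 0)) refl S c ⟩
      0# ∎)
      where
      S = sum (λ i → s i * a (punchIn r i) zero)
      c = a r (suc j)

  -- If `k` exceeded `m`, the coordinate vectors of the `u i` with respect to `v` would satisfy a
  -- nontrivial relation by `dependence`, and the same relation would kill the `u i` themselves.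
  independent-bound : ∀ {N k m} {u : Fin k → Point N} {v : Fin m → Point N} → LinearlyIndependent u →
             (∀ i → ∃ λ t → u i ≋ combination t v) → k ≤ℕ m
  independent-bound {k = k} {m} {u} {v} independent inSpan with k ℕ.≤? m
  ... | yes k≤m = k≤m
  ... | no k≰m  = contradiction (independent t t-kills (proj₁ nonzero)) (proj₂ nonzero)
    where
    a = λ i → proj₁ (inSpan i)
    relation = dependence (≰⇒> k≰m) a
    t        = proj₁ relation
    nonzero  = proj₂ (proj₂ relation)
    t-kills : combination t u ≋ 𝟎
    t-kills j = begin
      combination t u j
        ≈⟨ sum-cong-≋ (λ i → *-congˡ (proj₂ (inSpan i) j)) ⟩
      combination t (λ i → combination (a i) v) j   ≈⟨ combination-combination t a v j ⟩
      combination (combination t a) v j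
        ≈⟨ sum-zero _ (λ l → trans (*-congʳ (proj₁ (proj₂ relation) l)) (zeroˡ _)) ⟩
      0#                                            ∎

  -- Each `u i` is a difference of two points of `F`; the base point `q` cancels in it, which leaves
  -- an element of the span of `v`.
  affine-bound : ∀ {N k m} {p q : Point N} {u : Fin k → Point N} {v : Fin m → Point N} {F : Subset N} →
    LinearlyIndependent u → p ∈ F → (∀ i → p ⊕ u i ∈ F) →
    (∀ {x} → x ∈ F → ∃ λ t → x ≋ q ⊕ combination t v) → k ≤ℕ m
  affine-bound {p = p} {q} {u} {v} independent p∈F p+u∈F hull =
    independent-bound independent λ i →
      let s , p≋   = hull p∈F
          t , p+u≋ = hull (p+u∈F i)
      in (λ l → t l - s l) , λ j → begin
        u i j
          ≈⟨ solve 2 (λ a b → b := (a :+ b) :- a) refl (p j) (u i j) ⟩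
        (p j + u i j) - p j                                 ≈⟨ +-cong (p+u≋ j) (-‿cong (p≋ j)) ⟩
        (q j + combination t v j) - (q j + combination s v j)
          ≈⟨ solve 3 (λ a b c → (a :+ b) :- (a :+ c) := b :- c) refl
               (q j) (combination t v j) (combination s v j) ⟩
        combination t v j - combination s v j               ≈⟨ combination-⊖ t s v j ⟨
        combination (λ l → t l - s l) v j                   ∎

  -- Boxes and their faces.

  inner-congʳ : ∀ {N} (c : Point N) {x y : Point N} → x ≋ y → ⟨ c , x ⟩ ≈ ⟨ c , y ⟩
  inner-congʳ c x≋y = sum-cong-≋ (λ i → *-congˡ (x≋y i))

  inner-⊕⊙ : ∀ {N} (c x : Point N) t (y : Point N) → ⟨ c , x ⊕ t ⊙ y ⟩ ≈ ⟨ c , x ⟩ + t * ⟨ c , y ⟩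
  inner-⊕⊙ c x t y = begin
    sum (λ i → c i * (x i + t * y i))
      ≈⟨ sum-cong-≋ (λ i → solve 4 (λ a b d e → a :* (b :+ d :* e) := a :* b :+ d :* (a :* e)) refl
           (c i) (x i) t (y i)) ⟩
    sum (λ i → c i * x i + t * (c i * y i))
      ≈⟨ ∑-distrib-+ (λ i → c i * x i) (λ i → t * (c i * y i)) ⟩
    ⟨ c , x ⟩ + sum (λ i → t * (c i * y i))
      ≈⟨ +-congˡ (*-distribˡ-sum t (λ i → c i * y i)) ⟨
    ⟨ c , x ⟩ + t * ⟨ c , y ⟩ ∎

  UnitInterval : Pred Carrier 0ℓ
  UnitInterval t = 0# ≤ t × t ≤ 1#

  0∈UnitInterval : 0# ∈ UnitInterval
  0∈UnitInterval = ≤-refl , 0≤1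

  1∈UnitInterval : 1# ∈ UnitInterval
  1∈UnitInterval = 0≤1 , ≤-refl

  δ∈UnitInterval : ∀ {n} (i j : Fin n) → δ i j ∈ UnitInterval
  δ∈UnitInterval i j with does (i Fin.≟ j)
  ... | true  = 1∈UnitInterval
  ... | false = 0∈UnitInterval

  corner∈box : ∀ {N m} (p : Point N) (v : Fin m → Point N) → p ∈ box p v
  corner∈box p v = (λ _ → 0#) , (λ _ → 0∈UnitInterval) , λ j → sym (trans
    (+-congˡ (sum-zero _ (λ i → zeroˡ (v i j)))) (+-identityʳ (p j)))

  vertex∈box : ∀ {N m} (p : Point N) (v : Fin m → Point N) i → p ⊕ v i ∈ box p v
  vertex∈box p v i = δ i , δ∈UnitInterval i , λ j → +-congˡ (sym (combination-δ v i j))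

  box-hull : ∀ {N m} {p : Point N} {v : Fin m → Point N} {x} → x ∈ box p v →
             ∃ λ t → x ≋ p ⊕ combination t v
  box-hull (t , _ , x≋) = t , x≋

  -- Splits off the first generator, so that boxes can be treated by induction on the number of
  -- generators; `box-cons⁺` is the converse.
  box-cons⁻ : ∀ {N m} {p : Point N} (v : Fin (suc m) → Point N) {x} → x ∈ box p v →
              ∃₂ λ t y → t ∈ UnitInterval × y ∈ box p (v ∘ suc) × x ≋ y ⊕ t ⊙ v zero
  box-cons⁻ {p = p} v (t , bounds , x≋) =
    t zero , p ⊕ combination (t ∘ suc) (v ∘ suc) , bounds zero ,
    (t ∘ suc , bounds ∘ suc , ≋-refl) ,
    λ j → trans (x≋ j) (solve 3 (λ a b c → a :+ (b :+ c) := (a :+ c) :+ b) refl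
      (p j) (t zero * v zero j) (combination (t ∘ suc) (v ∘ suc) j))

  box-cons⁺ : ∀ {N m} {p : Point N} (v : Fin (suc m) → Point N) {x y t} →
              t ∈ UnitInterval → y ∈ box p (v ∘ suc) → x ≋ y ⊕ t ⊙ v zero → x ∈ box p v
  box-cons⁺ {p = p} v {t = t} t-bounds (s , bounds , y≋) x≋ =
    t Vector.∷ s , (λ { zero → t-bounds ; (suc i) → bounds i }) ,
    λ j → trans (x≋ j) (trans (+-congʳ (y≋ j)) (solve 3 (λ a b c → (a :+ c) :+ b := a :+ (b :+ c)) refl
      (p j) (t * v zero j) (combination s (v ∘ suc) j)))

  box-shift⁻ : ∀ {N m} {p u : Point N} {v : Fin m → Point N} {x} → x ∈ box (p ⊕ u) v →
               ∃ λ y → y ∈ box p v × x ≋ y ⊕ u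
  box-shift⁻ {p = p} {u} {v} (t , bounds , x≋) = p ⊕ combination t v , (t , bounds , ≋-refl) ,
    λ j → trans (x≋ j) (solve 3 (λ a b c → (a :+ b) :+ c := (a :+ c) :+ b) refl
         (p j) (u j) (combination t v j))

  box-shift⁺ : ∀ {N m} {p u : Point N} {v : Fin m → Point N} {x y} → y ∈ box p v → x ≋ y ⊕ u →
               x ∈ box (p ⊕ u) v
  box-shift⁺ {p = p} {u} {v} (t , bounds , y≋) x≋ = t , bounds ,
    λ j → trans (x≋ j) (trans (+-congʳ (y≋ j))
      (solve 3 (λ a b c → (a :+ c) :+ b := (a :+ b) :+ c) refl (p j) (u j) (combination t v j)))

  -- The shape of a nonempty face of a box on `v`: `e` selects the generators whose coefficients
  -- stay free, and the contribution of the others, fixed at an endpoint, is absorbed into `p`.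
  SubBox : ∀ {N m} → Subset N → (Fin m → Point N) → Set
  SubBox {N} {m} F v = ∃ λ m′ → ∃₂ λ (p : Point N) (e : Fin m′ → Fin m) →
    Injective _≡_ _≡_ e × F ≐ box p (v ∘ e)

  Slice : ∀ {N} → Subset N → Point N → Carrier → Subset N
  Slice P c b x = x ∈ P × ⟨ c , x ⟩ ≈ b

  *-cancelʳ-≤ : ∀ {x y z} → ¬ (z ≤ 0#) → x * z ≤ y * z → x ≤ y
  *-cancelʳ-≤ {x} {y} {z} z>0 xz≤yz = ≤-stable λ x≰y →
    positive-* (gap x≰y) z>0 (+-cancelˡ-≤ (y * z)
      (≤-respˡ-≈ (solve 3 (λ x y z → x :* z := y :* z :+ (x :- y) :* z) refl x y z)
        (≤-respʳ-≈ (sym (+-identityʳ (y * z))) xz≤yz)))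

  *-cancelʳ-≤-neg : ∀ {x y z} → ¬ (0# ≤ z) → x * z ≤ y * z → y ≤ x
  *-cancelʳ-≤-neg {x} {y} {z} z<0 xz≤yz = *-cancelʳ-≤ -z>0 (0≤y-x⇒x≤y
    (≤-respʳ-≈ (solve 3 (λ x y z → y :* z :- x :* z := x :* :- z :- y :* :- z) refl x y z)
      (x≤y⇒0≤y-x xz≤yz)))
    where
    -z>0 : ¬ (- z ≤ 0#)
    -z>0 -z≤0 = z<0 (≤-respʳ-≈ (solve 1 (λ z → :- (:- z) := z) refl z) (x≤0⇒0≤-x -z≤0))

  -- Induction on the generators: by the sign of `γ` the first coefficient is free or pinned to an
  -- endpoint, and the slice reduces to one of a box on `v ∘ suc`.
  slice-of-box : ∀ {N m} c b (p : Point N) (v : Fin m → Point N) →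
                 (∀ {x} → x ∈ box p v → ⟨ c , x ⟩ ≤ b) → ∃ (Slice (box p v) c b) →
                 SubBox (Slice (box p v) c b) v
  -- Without generators the box is a single point, and the given inhabitant shows that it attains
  -- `b`.
  slice-of-box {m = ℕ.zero} c b p v valid (x₀ , x₀∈ , ⟨c,x₀⟩≈b) =
    0 , p , id , id , proj₁ , λ x∈@(_ , _ , x≋) → x∈ ,
    trans (inner-congʳ c (≋-trans x≋ (≋-sym (proj₂ (proj₂ x₀∈))))) ⟨c,x₀⟩≈b
  slice-of-box {N} {suc m} c b p v valid (x₀ , x₀∈ , ⟨c,x₀⟩≈b) = bySign
    where
    γ = ⟨ c , v zero ⟩

    slice-cons : ∀ y t {x} → x ≋ y ⊕ t ⊙ v zero → ⟨ c , x ⟩ ≈ ⟨ c , y ⟩ + t * γ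
    slice-cons y t x≋ = trans (inner-congʳ c x≋) (inner-⊕⊙ c y t (v zero))

    free : γ ≈ 0# → SubBox (Slice (box p v) c b) v
    free γ≈0 = extend (slice-of-box c b p (v ∘ suc) tail-valid tail-inhabited)
      where
      invariant : ∀ y t {x} → x ≋ y ⊕ t ⊙ v zero → ⟨ c , x ⟩ ≈ ⟨ c , y ⟩
      invariant y t x≋ = trans (slice-cons y t x≋)
        (trans (+-congˡ (trans (*-congˡ γ≈0) (zeroʳ t))) (+-identityʳ _))
      tail-valid : ∀ {y} → y ∈ box p (v ∘ suc) → ⟨ c , y ⟩ ≤ b
      tail-valid {y} y∈ = ≤-respˡ-≈ (invariant y 0# ≋-refl) (valid (box-cons⁺ v 0∈UnitInterval y∈ ≋-refl))
      tail-inhabited : ∃ (Slice (box p (v ∘ suc)) c b)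
      tail-inhabited with box-cons⁻ v x₀∈
      ... | t , y , _ , y∈ , x₀≋ = y , y∈ , trans (sym (invariant y t x₀≋)) ⟨c,x₀⟩≈b
      extend : SubBox (Slice (box p (v ∘ suc)) c b) (v ∘ suc) → SubBox (Slice (box p v) c b) v
      extend (m′ , p′ , e , e-injective , ⊆box , box⊆) =
        suc m′ , p′ , Fin.lift 1 e , lift-injective e e-injective 1 , to , from
        where
        to : Slice (box p v) c b ⊆ box p′ (v ∘ Fin.lift 1 e)
        to (x∈ , ⟨c,x⟩≈b) with box-cons⁻ v x∈
        ... | t , y , t-bounds , y∈ , x≋ =
          box-cons⁺ (v ∘ Fin.lift 1 e) t-bounds (⊆box (y∈ , trans (sym (invariant y t x≋)) ⟨c,x⟩≈b)) x≋
        from : box p′ (v ∘ Fin.lift 1 e) ⊆ Slice (box p v) c b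
        from x∈ with box-cons⁻ (v ∘ Fin.lift 1 e) x∈
        ... | t , y , t-bounds , y∈ , x≋ with box⊆ y∈
        ...   | y∈′ , ⟨c,y⟩≈b = box-cons⁺ v t-bounds y∈′ x≋ , trans (invariant y t x≋) ⟨c,y⟩≈b

    -- `ε` is the endpoint at which `t * γ` is largest, and `extremal` says that no other
    -- coefficient does as well.
    pinned : ∀ ε → ε ∈ UnitInterval →
             (∀ {t} → t ∈ UnitInterval → ε * γ ≤ t * γ → t ≈ ε) → SubBox (Slice (box p v) c b) v
    pinned ε ε-bounds extremal = shrink (slice-of-box c b (p ⊕ ε ⊙ v zero) (v ∘ suc)
        (λ x∈ → valid (embed x∈)) (x₀ , restrict (x₀∈ , ⟨c,x₀⟩≈b) , ⟨c,x₀⟩≈b))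
      where
      embed : box (p ⊕ ε ⊙ v zero) (v ∘ suc) ⊆ box p v
      embed x∈ with box-shift⁻ x∈
      ... | y , y∈ , x≋ = box-cons⁺ v ε-bounds y∈ x≋
      restrict : Slice (box p v) c b ⊆ box (p ⊕ ε ⊙ v zero) (v ∘ suc)
      restrict (x∈ , ⟨c,x⟩≈b) with box-cons⁻ v x∈
      ... | t , y , t-bounds , y∈ , x≋ =
        box-shift⁺ y∈ (≋-trans x≋ (λ j → +-congˡ (*-congʳ (extremal t-bounds εγ≤tγ))))
        where
        -- Replacing the coefficient `t` of `x` by `ε` stays inside the box, so the value cannot
        -- rise above `b`, which `x` attains.
        εγ≤tγ : ε * γ ≤ t * γ
        εγ≤tγ = +-cancelˡ-≤ ⟨ c , y ⟩ (≤-respˡ-≈ (slice-cons y ε ≋-refl)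
          (≤-respʳ-≈ (trans (sym ⟨c,x⟩≈b) (slice-cons y t x≋))
            (valid (box-cons⁺ v ε-bounds y∈ ≋-refl))))
      shrink : SubBox (Slice (box (p ⊕ ε ⊙ v zero) (v ∘ suc)) c b) (v ∘ suc) →
               SubBox (Slice (box p v) c b) v
      shrink (m′ , p′ , e , e-injective , ⊆box , box⊆) =
        m′ , p′ , suc ∘ e , e-injective ∘ suc-injective ,
        (λ x∈ → ⊆box (restrict x∈ , proj₂ x∈)) ,
        (λ x∈ → embed (proj₁ (box⊆ x∈)) , proj₂ (box⊆ x∈))

    bySign : SubBox (Slice (box p v) c b) v
    bySign with γ ≤? 0# | 0# ≤? γ
    ... | yes γ≤0 | yes 0≤γ = free (antisym γ≤0 0≤γ)
    ... | no γ>0  | _       = pinned 1# 1∈UnitInterval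
      λ (_ , t≤1) γ≤tγ → antisym t≤1 (*-cancelʳ-≤ γ>0 γ≤tγ)
    ... | yes _   | no γ<0  = pinned 0# 0∈UnitInterval
      λ (0≤t , _) 0γ≤tγ → antisym (*-cancelʳ-≤-neg γ<0 0γ≤tγ) 0≤t

  face-of-box : ∀ {N m} {p : Point N} {v : Fin m → Point N} {F P : Subset N} →
                P ≐ box p v → IsFace F P → ∃ F → SubBox F v
  face-of-box {p = p} {v} (P⊆ , ⊆P) (c , b , valid , F⊆ , ⊆F) (x₀ , x₀∈) with
    slice-of-box c b p v (λ x∈ → valid (⊆P x∈))
      (x₀ , P⊆ (proj₁ (F⊆ x₀∈)) , proj₂ (F⊆ x₀∈))
  ... | m′ , p′ , e , e-injective , ⊆box , box⊆ = m′ , p′ , e , e-injective ,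
    (λ x∈ → ⊆box (P⊆ (proj₁ (F⊆ x∈)) , proj₂ (F⊆ x∈))) ,
    (λ x∈ → ⊆F (⊆P (proj₁ (box⊆ x∈)) , proj₂ (box⊆ x∈)))

  -- The dimension of a box.

  dimension-lower : ∀ {N k m} {p : Point N} {v : Fin m → Point N} {F : Subset N} →
                    HasDimension k F → LinearlyIndependent v → p ∈ F → (∀ i → p ⊕ v i ∈ F) → m ≤ℕ k
  dimension-lower (q , u , _ , _ , _ , hull) independent p∈ p+v∈ =
    affine-bound independent p∈ p+v∈ hull

  dimension-upper : ∀ {N k m} {p : Point N} {v : Fin m → Point N} {F : Subset N} →
                    HasDimension k F → F ⊆ box p v → k ≤ℕ m
  dimension-upper (q , u , q∈ , q+u∈ , independent , _) F⊆box =
    affine-bound independent q∈ q+u∈ (λ x∈ → box-hull (F⊆box x∈))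

  -- The corner and the points `p ⊕ v i` bound the dimension from below, the affine hull of the box
  -- from above.
  box-dimension : ∀ {N k m} {p : Point N} {v : Fin m → Point N} {F : Subset N} →
                  LinearlyIndependent v → F ≐ box p v → HasDimension k F → m ≡ k
  box-dimension {p = p} {v} independent (F⊆ , ⊆F) dim = ℕ.≤-antisym
    (dimension-lower dim independent (⊆F (corner∈box p v)) (λ i → ⊆F (vertex∈box p v i)))
    (dimension-upper dim F⊆)

  -- Norms compared through their squares.

  ‖‖-nonneg : ∀ {N} (x : Point N) → 0# ≤ ‖ x ‖
  ‖‖-nonneg x = proj₁ (proj₂ (√-exists ⟨ x , x ⟩ (⟨x,x⟩-nonneg x)))

  ‖‖-square : ∀ {N} (x : Point N) → ‖ x ‖ * ‖ x ‖ ≈ ⟨ x , x ⟩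
  ‖‖-square x = proj₂ (proj₂ (√-exists ⟨ x , x ⟩ (⟨x,x⟩-nonneg x)))

  square-cancel-≤ : ∀ {x y} → 0# ≤ y → x * x ≤ y * y → x ≤ y
  square-cancel-≤ {x} {y} 0≤y x²≤y² = ≤-stable λ x≰y →
    let y≤x = ≰⇒≥ x≰y
        x>0 = λ x≤0 → x≰y (≤-trans x≤0 0≤y)
    in x≰y (*-cancelʳ-≤ x>0 (≤-trans x²≤y² (*-monoʳ-≤ 0≤y y≤x)))

  ‖‖-mono : ∀ {M N} {x : Point M} {y : Point N} → ⟨ x , x ⟩ ≤ ⟨ y , y ⟩ → ‖ x ‖ ≤ ‖ y ‖
  ‖‖-mono {x = x} {y} p = square-cancel-≤ (‖‖-nonneg y)
    (≤-respˡ-≈ (sym (‖‖-square x)) (≤-respʳ-≈ (sym (‖‖-square y)) p))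

  ‖‖-mono⁻¹ : ∀ {M N} {x : Point M} {y : Point N} → ‖ x ‖ ≤ ‖ y ‖ → ⟨ x , x ⟩ ≤ ⟨ y , y ⟩
  ‖‖-mono⁻¹ {x = x} {y} p = ≤-respˡ-≈ (‖‖-square x) (≤-respʳ-≈ (‖‖-square y)
    (*-mono-≤ (‖‖-nonneg x) p (‖‖-nonneg x) p))

  ‖‖-cong : ∀ {M N} {x : Point M} {y : Point N} → ⟨ x , x ⟩ ≈ ⟨ y , y ⟩ → ‖ x ‖ ≈ ‖ y ‖
  ‖‖-cong {x = x} {y} p = antisym (‖‖-mono {x = x} {y} (≤-reflexive p))
    (‖‖-mono {x = y} {x} (≤-reflexive (sym p)))

  1≤[1+n]×1 : ∀ n → 1# ≤ suc n ×ℕ 1#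
  n×1-nonneg : ∀ n → 0# ≤ n ×ℕ 1#
  1≤[1+n]×1 n = x≤x+y (n×1-nonneg n)
  n×1-nonneg ℕ.zero  = ≤-refl
  n×1-nonneg (suc n) = ≤-trans 0≤1 (1≤[1+n]×1 n)

  -- Permutations extending injections.

  -- Induction on `m`: the permutation for the tails is followed by the transposition that takes the
  -- current image of `e zero` to `f zero`. By injectivity of `e` and `f`, the transposition fixes
  -- every `f (suc i)`.
  injections-conjugate : ∀ {m N} (e f : Fin m → Fin N) → Injective _≡_ _≡_ e → Injective _≡_ _≡_ f →
                         ∃ λ (σ : Permutation′ N) → ∀ i → σ ⟨$⟩ʳ e i ≡ f i
  injections-conjugate {ℕ.zero} e f _ _ = Perm.id , λ ()
  injections-conjugate {suc m} {N} e f e-injective f-injective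
    with injections-conjugate (e ∘ suc) (f ∘ suc)
           (suc-injective ∘ e-injective) (suc-injective ∘ f-injective)
  ... | σ , σe≗f = σ Perm.∘ₚ Perm.transpose (σ ⟨$⟩ʳ e zero) (f zero) , agrees
    where
    agrees : ∀ i → Perm.transpose (σ ⟨$⟩ʳ e zero) (f zero) ⟨$⟩ʳ (σ ⟨$⟩ʳ e i) ≡ f i
    agrees zero rewrite dec-true ((σ ⟨$⟩ʳ e zero) Fin.≟ (σ ⟨$⟩ʳ e zero)) ≡.refl = ≡.refl
    agrees (suc i)
      rewrite dec-false ((σ ⟨$⟩ʳ e (suc i)) Fin.≟ (σ ⟨$⟩ʳ e zero))
                (λ eq → Fin.0≢1+n (≡.sym (e-injective (Injection.injective (↔⇒↣ σ) eq))))
            | σe≗f i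
            | dec-false (f (suc i) Fin.≟ f zero) (λ eq → Fin.0≢1+n (≡.sym (f-injective eq))) = ≡.refl

  -- Integers, distances and roots.

  IsInteger : Pred Carrier 0ℓ
  IsInteger x = ∃ λ z → x ≈ fromℤ z

  n×1≤square : ∀ k → k ×ℕ 1# ≤ k ×ℕ 1# * (k ×ℕ 1#)
  n×1≤square ℕ.zero  = ≤-reflexive (sym (zeroˡ 0#))
  n×1≤square (suc k) = ≤-respˡ-≈ (*-identityʳ _)
    (*-monoʳ-≤ (n×1-nonneg (suc k)) (1≤[1+n]×1 k))

  -- Here integrality of lattice vectors enters, since the first bound fails strictly between 0 and
  -- 1. Both signs of `x` reduce to a nonnegative `y` with `y ≤ y * y`, for which `- y ≤ y * y` also
  -- holds.
  integer≤square : ∀ {x} → IsInteger x → x ≤ x * x × - x ≤ x * x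
  integer≤square {x} (z , x≈z) = bounds z x≈z
    where
    module _ {y} (0≤y : 0# ≤ y) (y≤yy : y ≤ y * y) where
      -y≤yy : - y ≤ y * y
      -y≤yy = ≤-trans (0≤y-x⇒x≤y (≤-respʳ-≈ (solve 1 (λ y → y := con (0 , 0) :- :- y) refl
           y) 0≤y)) (0≤x*x y)
      positive : x ≈ y → x ≤ x * x × - x ≤ x * x
      positive x≈y =
        ≤-respˡ-≈ (sym x≈y) (≤-respʳ-≈ (sym (*-cong x≈y x≈y)) y≤yy) ,
        ≤-respˡ-≈ (sym (-‿cong x≈y)) (≤-respʳ-≈ (sym (*-cong x≈y x≈y)) -y≤yy)
      negative : x ≈ - y → x ≤ x * x × - x ≤ x * x
      negative x≈-y =
        ≤-respˡ-≈ (sym x≈-y) (≤-respʳ-≈ yy≈xx -y≤yy) ,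
        ≤-respˡ-≈ (trans (solve 1 (λ y → y := :- (:- y)) refl
             y) (sym (-‿cong x≈-y))) (≤-respʳ-≈ yy≈xx y≤yy)
        where
        yy≈xx : y * y ≈ x * x
        yy≈xx = trans (solve 1 (λ y → y :* y := :- y :* :- y) refl y) (sym (*-cong x≈-y x≈-y))
    bounds : ∀ z → x ≈ fromℤ z → x ≤ x * x × - x ≤ x * x
    bounds (+ k)    = positive (n×1-nonneg k) (n×1≤square k)
    bounds -[1+ k ] = negative (n×1-nonneg (suc k)) (n×1≤square (suc k))

  sum-inner-𝟏 : ∀ {N} (x : Point N) → ⟨ x , 𝟏 ⟩ ≈ sum x
  sum-inner-𝟏 x = sum-cong-≋ (λ i → *-identityʳ (x i))

  inner-⊖ : ∀ {N} (x q : Point N) → ⟨ x ⊖ q , x ⊖ q ⟩ + (⟨ x , q ⟩ + ⟨ x , q ⟩) ≈ ⟨ x , x ⟩ + ⟨ q , q ⟩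
  inner-⊖ x q = begin
    ⟨ x ⊖ q , x ⊖ q ⟩ + (⟨ x , q ⟩ + ⟨ x , q ⟩)
      ≈⟨ +-congˡ (∑-distrib-+ (λ i → x i * q i) (λ i → x i * q i)) ⟨
    ⟨ x ⊖ q , x ⊖ q ⟩ + sum (λ i → x i * q i + x i * q i)
      ≈⟨ ∑-distrib-+ (λ i → (x i - q i) * (x i - q i)) (λ i → x i * q i + x i * q i) ⟨
    sum (λ i → (x i - q i) * (x i - q i) + (x i * q i + x i * q i))
      ≈⟨ sum-cong-≋ (λ i → solve 2 (λ x q → (x :- q) :* (x :- q) :+ (x :* q :+ x :* q) := x :* x :+ q :* q) refl
           (x i) (q i)) ⟩
    sum (λ i → x i * x i + q i * q i)
      ≈⟨ ∑-distrib-+ (λ i → x i * x i) (λ i → q i * q i) ⟩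
    ⟨ x , x ⟩ + ⟨ q , q ⟩ ∎

  -- Expanding the squared distance cancels `⟨ x , x ⟩` and makes the Voronoi condition linear in
  -- `x`; `closer-than⁻¹` is the converse.
  closer-than : ∀ {N} (x q : Point N) → ⟨ x , q ⟩ + ⟨ x , q ⟩ ≤ ⟨ q , q ⟩ → ‖ x ‖ ≤ ‖ x ⊖ q ‖
  closer-than x q p = ‖‖-mono {x = x} {x ⊖ q} (+-cancelˡ-≤ (⟨ x , q ⟩ + ⟨ x , q ⟩)
    (≤-respʳ-≈ (trans (sym (inner-⊖ x q)) (+-comm _ _))
      (≤-respˡ-≈ (+-comm _ _) (+-monoʳ-≤ ⟨ x , x ⟩ p))))

  closer-than⁻¹ : ∀ {N} (x q : Point N) → ‖ x ‖ ≤ ‖ x ⊖ q ‖ → ⟨ x , q ⟩ + ⟨ x , q ⟩ ≤ ⟨ q , q ⟩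
  closer-than⁻¹ x q p = +-cancelˡ-≤ ⟨ x , x ⟩ (≤-respʳ-≈ (inner-⊖ x q)
    (+-mono-≤ (‖‖-mono⁻¹ {x = x} {x ⊖ q} p) ≤-refl))

  -- The roots of type A for distinct `i` and `j`: the lattice vectors against which points of the
  -- Voronoi cell are tested.
  root : ∀ {N} → Fin N → Fin N → Point N
  root i j l = δ i l - δ j l

  inner-root : ∀ {N} (x : Point N) i j → ⟨ root i j , x ⟩ ≈ x i - x j
  inner-root x i j = begin
    sum (λ l → (δ i l - δ j l) * x l)
      ≈⟨ sum-cong-≋ (λ l → solve 3 (λ a b c → (a :- b) :* c := a :* c :+ :- (b :* c)) refl
           (δ i l) (δ j l) (x l)) ⟩
    sum (λ l → δ i l * x l + - (δ j l * x l))
      ≈⟨ ∑-distrib-+ (λ l → δ i l * x l) (λ l → - (δ j l * x l)) ⟩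
    sum (λ l → δ i l * x l) + sum (λ l → - (δ j l * x l))
      ≈⟨ +-cong (sum-δʳ x i) (trans (sum-neg (λ l → δ j l * x l)) (-‿cong (sum-δʳ x j))) ⟩
    x i - x j ∎

  minimum : ∀ {m} (x : Fin (suc m) → Carrier) → ∃ λ j → ∀ i → x j ≤ x i
  minimum {ℕ.zero} x = zero , λ { zero → ≤-refl }
  minimum {suc m} x with minimum (x ∘ suc)
  ... | j , least with total (x zero) (x (suc j))
  ...   | inj₁ x₀≤ = zero , λ { zero → ≤-refl ; (suc i) → ≤-trans x₀≤ (least i) }
  ...   | inj₂ ≤x₀ = suc j , λ { zero → ≤x₀ ; (suc i) → least i }

  -- The projected basis vectors and their independence.

  module Edges (n : ℕ) where
    N = suc n

    N×1≉0 : ¬ (N ×ℕ 1# ≈ 0#)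
    N×1≉0 eq = 1≰0 (≤-respʳ-≈ eq (1≤[1+n]×1 n))

    ν : Carrier
    ν = proj₁ (inverse (N ×ℕ 1#) N×1≉0)

    -- The orthogonal projections onto H of the standard basis vectors.
    w : Fin N → Point N
    w i j = δ i j - ν

    sum-constant : ∀ a → sum {N} (λ _ → a) ≈ N ×ℕ 1# * a
    sum-constant a = trans (sum-replicate N)
      (trans (×-congʳ N (sym (*-identityˡ a))) (sym (×-assoc-* N 1# a)))

    N*ν-cancel : ∀ a → N ×ℕ 1# * (a * ν) ≈ a
    N*ν-cancel a = trans (solve 3 (λ x a y → x :* (a :* y) := a :* (x :* y)) refl (N ×ℕ 1#) a ν)
      (trans (*-congˡ (proj₂ (inverse (N ×ℕ 1#) N×1≉0))) (*-identityʳ a))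

    combination-w : ∀ {m} (t : Fin m → Carrier) (e : Fin m → Fin N) j →
                    combination t (w ∘ e) j ≈ sum (λ i → t i * δ (e i) j) - sum t * ν
    combination-w t e j = begin
      sum (λ i → t i * (δ (e i) j - ν))
        ≈⟨ sum-cong-≋ (λ i → solve 3 (λ a b c → a :* (b :- c) := a :* b :+ :- (a :* c)) refl
             (t i) (δ (e i) j) ν) ⟩
      sum (λ i → t i * δ (e i) j + - (t i * ν))
        ≈⟨ ∑-distrib-+ (λ i → t i * δ (e i) j) (λ i → - (t i * ν)) ⟩
      sum (λ i → t i * δ (e i) j) + sum (λ i → - (t i * ν))
        ≈⟨ +-congˡ (trans (sum-neg (λ i → t i * ν)) (-‿cong (sym (*-distribʳ-sum ν t)))) ⟩
      sum (λ i → t i * δ (e i) j) - sum t * ν ∎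

    combination-w-hit : ∀ {m} (t : Fin m → Carrier) (e : Fin m → Fin N) → Injective _≡_ _≡_ e → ∀ l →
                        combination t (w ∘ e) (e l) ≈ t l - sum t * ν
    combination-w-hit t e e-injective l = trans (combination-w t e (e l)) (+-congʳ (trans
      (sum-single _ l (λ i i≢l → trans (*-congˡ (δ-offDiagonal (i≢l ∘ e-injective))) (zeroʳ (t i))))
      (trans (*-congˡ (δ-diagonal (e l))) (*-identityʳ (t l)))))

    -- Marks a proper subfamily `w ∘ e`. The sum of all `w i` is zero, so the full family is
    -- dependent; at a missed coordinate every `w (e i)` equals `- ν`.
    Misses : ∀ {m} → (Fin m → Fin N) → Set
    Misses e = ∃ λ o → ∀ i → e i ≢ o

    -- At the missed coordinate `o` a vanishing combination reads `- (sum t * ν) ≈ 0#`; with this,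
    -- coordinate `e i` reads `t i ≈ 0#`.
    w-independent : ∀ {m} {e : Fin m → Fin N} → Injective _≡_ _≡_ e → Misses e →
                    LinearlyIndependent (w ∘ e)
    w-independent {e = e} e-injective (o , e≢o) t t-kills i = begin
      t i
        ≈⟨ solve 2 (λ a b → a := (a :- b) :+ b) refl (t i) (sum t * ν) ⟩
      (t i - sum t * ν) + sum t * ν
        ≈⟨ +-cong (trans (sym (combination-w-hit t e e-injective i)) (t-kills (e i))) mean≈0 ⟩
      0# + 0#                                     ≈⟨ +-identityˡ 0# ⟩
      0#                                          ∎
      where
      mean≈0 : sum t * ν ≈ 0#
      mean≈0 = begin
        sum t * ν              ≈⟨ solve 1 (λ a → a := :- (con (0 , 0) :- a)) refl (sum t * ν) ⟩
        - (0# - sum t * ν)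
          ≈⟨ -‿cong (trans (+-congʳ (sym (sum-zero _
               (λ l → trans (*-congˡ (δ-offDiagonal (e≢o l))) (zeroʳ (t l))))))
               (sym (combination-w t e o))) ⟩
        - combination t (w ∘ e) o ≈⟨ -‿cong (t-kills o) ⟩
        - 0#                   ≈⟨ solve 0 (:- con (0 , 0) := con (0 , 0)) refl ⟩
        0#                     ∎

    -- Coordinate permutations and congruence.

    w-permute : ∀ (σ : Permutation′ N) i j → w (σ ⟨$⟩ʳ i) (σ ⟨$⟩ʳ j) ≈ w i j
    w-permute σ i j with i Fin.≟ j
    ... | yes ≡.refl = +-congʳ (δ-diagonal (σ ⟨$⟩ʳ i))
    ... | no i≢j     = +-congʳ (δ-offDiagonal (i≢j ∘ Injection.injective (↔⇒↣ σ)))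

    w-length : ∀ i j → ‖ w i ‖ ≈ ‖ w j ‖
    w-length i j = ‖‖-cong {x = w i} {w j} (begin
      ⟨ w i , w i ⟩
        ≈⟨ sum-cong-≋ (λ l → *-cong (w-permute σ i l) (w-permute σ i l)) ⟨
      sum (λ l → w (σ ⟨$⟩ʳ i) (σ ⟨$⟩ʳ l) * w (σ ⟨$⟩ʳ i) (σ ⟨$⟩ʳ l))
        ≈⟨ sum-permute (λ l → w (σ ⟨$⟩ʳ i) l * w (σ ⟨$⟩ʳ i) l) σ ⟨
      ⟨ w (σ ⟨$⟩ʳ i) , w (σ ⟨$⟩ʳ i) ⟩
        ≡⟨ ≡.cong (λ k → ⟨ w k , w k ⟩) σi≡j ⟩
      ⟨ w j , w j ⟩ ∎)
      where
      swap = injections-conjugate {1} (λ _ → i) (λ _ → j)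
        (λ { {zero} {zero} _ → ≡.refl }) (λ { {zero} {zero} _ → ≡.refl })
      σ = proj₁ swap
      σi≡j = proj₂ swap zero

    boxes-congruent : ∀ {m} {p q : Point N} {e f : Fin m → Fin N} {F G : Subset N} →
                      Injective _≡_ _≡_ e → Injective _≡_ _≡_ f →
                      F ≐ box p (w ∘ e) → G ≐ box q (w ∘ f) → Congruent F G
    boxes-congruent {p = p} {q} {e} {f} {F} {G} e-injective f-injective (F⊆ , ⊆F) (G⊆ , ⊆G) =
      φ , isometry , λ y → mk⇔ onto into
      where
      σ = proj₁ (injections-conjugate e f e-injective f-injective)
      σe≡f = proj₂ (injections-conjugate e f e-injective f-injective)
      φ : Point N → Point N
      -- The coordinate permutation by `σ`, which sends `w (e i)` to `w (f i)`, conjugated by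
      -- translations so that the corner `p` goes to `q`.
      φ x j = q j + (x (σ ⟨$⟩ˡ j) - p (σ ⟨$⟩ˡ j))
      isometry : IsIsometry φ
      isometry x y = ‖‖-cong {x = φ x ⊖ φ y} {x ⊖ y} (begin
        ⟨ φ x ⊖ φ y , φ x ⊖ φ y ⟩
          ≈⟨ sum-cong-≋ (λ j → *-cong (difference j) (difference j)) ⟩
        sum (λ j → (x (σ ⟨$⟩ˡ j) - y (σ ⟨$⟩ˡ j)) * (x (σ ⟨$⟩ˡ j) - y (σ ⟨$⟩ˡ j)))
          ≈⟨ sum-permute (λ j → (x j - y j) * (x j - y j)) (Perm.flip σ) ⟨
        ⟨ x ⊖ y , x ⊖ y ⟩ ∎)
        where
        difference : ∀ j → (φ x ⊖ φ y) j ≈ x (σ ⟨$⟩ˡ j) - y (σ ⟨$⟩ˡ j)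
        difference j = solve 4 (λ q x p y → (q :+ (x :- p)) :- (q :+ (y :- p)) := x :- y) refl
          (q j) (x (σ ⟨$⟩ˡ j)) (p (σ ⟨$⟩ˡ j)) (y (σ ⟨$⟩ˡ j))
      w-image : ∀ i j → w (e i) (σ ⟨$⟩ˡ j) ≈ w (f i) j
      w-image i j = begin
        w (e i) (σ ⟨$⟩ˡ j)                       ≈⟨ w-permute σ (e i) (σ ⟨$⟩ˡ j) ⟨
        w (σ ⟨$⟩ʳ e i) (σ ⟨$⟩ʳ (σ ⟨$⟩ˡ j))       ≡⟨ ≡.cong₂ w (σe≡f i) (Perm.inverseʳ σ) ⟩
        w (f i) j                                ∎
      φ-box : ∀ {x} t → x ≋ p ⊕ combination t (w ∘ e) → φ x ≋ q ⊕ combination t (w ∘ f)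
      φ-box {x} t x≋ j = +-congˡ (begin
        x (σ ⟨$⟩ˡ j) - p (σ ⟨$⟩ˡ j)            ≈⟨ +-congʳ (x≋ (σ ⟨$⟩ˡ j)) ⟩
        (p (σ ⟨$⟩ˡ j) + combination t (w ∘ e) (σ ⟨$⟩ˡ j)) - p (σ ⟨$⟩ˡ j)
          ≈⟨ solve 2 (λ a b → (a :+ b) :- a := b) refl
               (p (σ ⟨$⟩ˡ j)) (combination t (w ∘ e) (σ ⟨$⟩ˡ j)) ⟩
        combination t (w ∘ e) (σ ⟨$⟩ˡ j)         ≈⟨ sum-cong-≋ (λ i → *-congˡ (w-image i j)) ⟩
        combination t (w ∘ f) j                  ∎)
      onto : ∀ {y} → y ∈ G → ∃ λ x → x ∈ F × φ x ≋ y
      onto y∈ with G⊆ y∈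
      ... | t , bounds , y≋ = p ⊕ combination t (w ∘ e) , ⊆F (t , bounds , ≋-refl) ,
        ≋-trans (φ-box t ≋-refl) (≋-sym y≋)
      into : ∀ {y} → ∃ (λ x → x ∈ F × φ x ≋ y) → y ∈ G
      into (x , x∈ , φx≋y) with F⊆ x∈
      ... | t , bounds , x≋ = ⊆G (t , bounds , ≋-trans (≋-sym φx≋y) (φ-box t x≋))

    -- Boxes on the projected basis vectors as hyper-rhombi.

    misses-∘ : ∀ {m k} {e : Fin m → Fin N} (f : Fin k → Fin m) → Misses e → Misses (e ∘ f)
    misses-∘ f (o , e≢o) = o , λ i → e≢o (f i)

    -- The invariant of the recursion through faces: `Misses` keeps the generators independent and
    -- is inherited by every subfamily.
    WBox : ∀ m → Subset N → Set
    WBox m F = ∃₂ λ (p : Point N) (e : Fin m → Fin N) → Injective _≡_ _≡_ e × Misses e × F ≐ box p (w ∘ e)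

    -- A face uses a subfamily of the generators, so it misses the same index; independence then
    -- forces the number of its generators to equal its dimension.
    face-of-wBox : ∀ {m k} {F G : Subset N} → WBox m F → IsFace G F → HasDimension k G → WBox k G
    face-of-wBox {m} {k} {F} {G} (p , e , e-injective , e-misses , F≐) G-face dim@(g , _ , g∈ , _) =
      fromSubBox (face-of-box {p = p} {w ∘ e} {G} {F} F≐ G-face (g , g∈))
      where
      fromSubBox : SubBox G (w ∘ e) → WBox k G
      fromSubBox (m′ , q , f , f-injective , G≐) = ≡.subst (λ m → WBox m G)
        (box-dimension {p = q} {w ∘ e ∘ f} {G}
          (w-independent {e = e ∘ f} (f-injective ∘ e-injective) (misses-∘ f e-misses)) G≐ dim)
        (q , e ∘ f , f-injective ∘ e-injective , misses-∘ f e-misses , G≐)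

    -- Facets are boxes of the same kind with one generator fewer, so induction applies to them, and
    -- equal numbers of generators make any two of them congruent.
    wBox-isHyperRhombus : ∀ m {F : Subset N} → WBox (2 ℕ.+ m) F → IsHyperRhombus (2 ℕ.+ m) F
    wBox-isHyperRhombus ℕ.zero (p , e , e-injective , e-misses , F≐) =
      rhombus (p , w ∘ e , w-independent e-injective e-misses , F≐ , w-length (e zero) (e (suc zero)))
    wBox-isHyperRhombus (suc m) {F} F-box@(p , e , e-injective , e-misses , F≐) =
      higher (s≤s (s≤s (s≤s z≤n))) (p , w ∘ e , w-independent e-injective e-misses , F≐)
        (λ G G-face dim → wBox-isHyperRhombus m (face-of-wBox F-box G-face dim))
        (λ G G′ G-face dim G′-face dim′ →
          wBoxes-congruent (face-of-wBox F-box G-face dim) (face-of-wBox F-box G′-face dim′))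
      where
      wBoxes-congruent : ∀ {G G′} → WBox (2 ℕ.+ m) G → WBox (2 ℕ.+ m) G′ → Congruent G G′
      wBoxes-congruent {G} {G′} (q , f , f-injective , _ , G≐) (q′ , f′ , f′-injective , _ , G′≐) =
        boxes-congruent {p = q} {q′} {f} {f′} {G} {G′} f-injective f′-injective G≐ G′≐

    -- The Voronoi cell as a projected cube.

    -- Vectors of `H` are orthogonal to constants. Paired with a lattice vector, a projected point
    -- may therefore be replaced by its coefficient vector in the cube.
    inner-shift : ∀ (q : Point N) → q ∈ H n → ∀ {x y : Point N} a →
                  (∀ i → x i ≈ y i - a) → ⟨ x , q ⟩ ≈ ⟨ y , q ⟩
    inner-shift q q∈H {x} {y} a x≈y-a = begin
      sum (λ i → x i * q i)
        ≈⟨ sum-cong-≋ (λ i → trans (*-congʳ (x≈y-a i))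
             (solve 3 (λ y a q → (y :- a) :* q := y :* q :+ :- a :* q) refl (y i) a (q i))) ⟩
      sum (λ i → y i * q i + - a * q i)
        ≈⟨ ∑-distrib-+ (λ i → y i * q i) (λ i → - a * q i) ⟩
      ⟨ y , q ⟩ + sum (λ i → - a * q i)
        ≈⟨ +-congˡ (trans (sym (*-distribˡ-sum (- a) q))
             (trans (*-congˡ (trans (sym (sum-inner-𝟏 q)) q∈H)) (zeroʳ (- a)))) ⟩
      ⟨ y , q ⟩ + 0#
        ≈⟨ +-identityʳ _ ⟩
      ⟨ y , q ⟩ ∎

    -- For integers z and 0 ≤ t ≤ 1 one has 2 t z ≤ z² + z, and the coordinates of
    -- a lattice vector sum to zero.
    box⊆VoronoiCell : box 𝟎 w ⊆ VoronoiCell n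
    box⊆VoronoiCell {x} (t , bounds , x≋) = x∈H , λ q (q∈ℤ , q∈H) → closer-than x q
      (≤-respˡ-≈ (sym (+-cong (inner-shift q q∈H _ shifted) (inner-shift q q∈H _ shifted)))
        (≤-respˡ-≈ (∑-distrib-+ (λ i → t i * q i) (λ i → t i * q i))
          (≤-trans (sum-mono _ _ (λ i → coordinate (bounds i) (q∈ℤ i)))
            (≤-reflexive (trans (∑-distrib-+ (λ i → q i * q i) q)
              (trans (+-congˡ (trans (sym (sum-inner-𝟏 q)) q∈H)) (+-identityʳ _)))))))
      where
      shifted : ∀ i → x i ≈ t i - sum t * ν
      shifted i = trans (x≋ i) (trans (+-identityˡ _) (combination-w-hit t id id i))
      x∈H : x ∈ H n
      x∈H = begin
        ⟨ x , 𝟏 ⟩                             ≈⟨ sum-inner-𝟏 x ⟩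
        sum x                                  ≈⟨ sum-cong-≋ shifted ⟩
        sum (λ i → t i - sum t * ν)            ≈⟨ ∑-distrib-+ t (λ _ → - (sum t * ν)) ⟩
        sum t + sum {N} (λ _ → - (sum t * ν))  ≈⟨ +-congˡ (trans (sum-neg {N} (λ _ → sum t * ν))
                                                    (-‿cong (trans (sum-constant (sum t * ν)) (N*ν-cancel (sum t))))) ⟩
        sum t - sum t                          ≈⟨ -‿inverseʳ (sum t) ⟩
        0#                                     ∎
      coordinate : ∀ {t z} → t ∈ UnitInterval → IsInteger z → t * z + t * z ≤ z * z + z
      -- The difference of the two sides is the convex combination, with weights `t` and `1# - t`,
      -- of `z * z - z` and `z * z + z`, both nonnegative at an integer.
      coordinate {t} {z} (0≤t , t≤1) z-integer = 0≤y-x⇒x≤y (≤-respʳ-≈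
        (solve 2 (λ t z → t :* (z :* z :- z) :+ (con (1 , 0) :- t) :* (z :* z :- :- z)
                          := (z :* z :+ z) :- (t :* z :+ t :* z)) refl t z)
        (≤-respˡ-≈ (+-identityˡ 0#) (+-mono-≤
          (*-nonneg 0≤t (x≤y⇒0≤y-x (proj₁ (integer≤square z-integer))))
          (*-nonneg (x≤y⇒0≤y-x t≤1) (x≤y⇒0≤y-x (proj₂ (integer≤square z-integer)))))))

    root∈A : ∀ i j → root i j ∈ A n
    root∈A i j = integral , trans (inner-root 𝟏 i j) (-‿inverseʳ 1#)
      where
      integral : ∀ l → IsInteger (root i j l)
      integral l with does (i Fin.≟ l) | does (j Fin.≟ l)
      ... | true  | true  = + 0 , -‿inverseʳ 1#
      ... | true  | false = + 1 , +-congˡ (solve 0 (:- con (0 , 0) := con (0 , 0)) refl)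
      ... | false | true  = -[1+ 0 ] , trans (+-identityˡ _) (-‿cong (sym (+-identityʳ 1#)))
      ... | false | false = + 0 , -‿inverseʳ 0#

    -- For distinct indices the root has squared length 2, so the linear Voronoi condition bounds
    -- twice the difference by 2.
    VoronoiCell-spread : ∀ {x} → x ∈ VoronoiCell n → ∀ i j → x i - x j ≤ 1#
    VoronoiCell-spread {x} (x∈H , closest) i j with i Fin.≟ j
    ... | yes ≡.refl = ≤-respˡ-≈ (sym (-‿inverseʳ (x i))) 0≤1
    ... | no i≢j     = ≤-stable λ d≰1 →
      -- Instead of halving: a difference `d` above 1 would satisfy `1# + d ≤ d + d ≤ 1# + 1#`,
      -- hence `d ≤ 1#`.
      d≰1 (+-cancelˡ-≤ 1# (≤-trans (+-mono-≤ (≰⇒≥ d≰1) ≤-refl) 2d≤2))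
      where
      q = root i j
      2d≤2 : (x i - x j) + (x i - x j) ≤ 1# + 1#
      2d≤2 = ≤-respˡ-≈ (+-cong xq xq) (≤-respʳ-≈ qq (closer-than⁻¹ x q (closest q (root∈A i j))))
        where
        xq : ⟨ x , q ⟩ ≈ x i - x j
        xq = trans (sum-cong-≋ (λ l → *-comm (x l) (q l))) (inner-root x i j)
        qq : ⟨ q , q ⟩ ≈ 1# + 1#
        qq = begin
          ⟨ q , q ⟩                          ≈⟨ inner-root q i j ⟩
          (δ i i - δ j i) - (δ i j - δ j j)
            ≈⟨ +-cong (+-cong (δ-diagonal i) (-‿cong (δ-offDiagonal (i≢j ∘ ≡.sym))))
                                                  (-‿cong (+-cong (δ-offDiagonal i≢j) (-‿cong (δ-diagonal j)))) ⟩
          (1# - 0#) - (0# - 1#)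
            ≈⟨ solve 0 ((con (1 , 0) :- con (0 , 0)) :- (con (0 , 0) :- con (1 , 0)) :=
                       con (1 , 0) :+ con (1 , 0)) refl
                 ⟩
          1# + 1#                            ∎

    -- Subtracting the smallest coordinate moves a point of the cell into the cube
    -- without changing its projection.
    VoronoiCell⊆box : VoronoiCell n ⊆ box 𝟎 w
    VoronoiCell⊆box {x} x∈V =
      t , (λ i → x≤y⇒0≤y-x (least i) , VoronoiCell-spread x∈V i j) , λ i → sym (begin
      0# + combination t w i       ≈⟨ +-identityˡ _ ⟩
      combination t w i            ≈⟨ combination-w-hit t id id i ⟩
      (x i - x j) - sum t * ν      ≈⟨ +-congˡ (-‿cong sum-t*ν) ⟩
      (x i - x j) - (- x j)        ≈⟨ solve 2 (λ a b → (a :- b) :- (:- b) := a) refl (x i) (x j) ⟩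
      x i                          ∎)
      where
      j     = proj₁ (minimum x)
      least = proj₂ (minimum x)
      t : Fin N → Carrier
      t i = x i - x j
      -- The coordinates of `x` sum to zero, so the mean of `t` is `- x j`, and subtracting it
      -- restores `x`.
      sum-t*ν : sum t * ν ≈ - x j
      sum-t*ν = begin
        sum t * ν                                  ≈⟨ *-congʳ (∑-distrib-+ x (λ _ → - x j)) ⟩
        (sum x + sum {N} (λ _ → - x j)) * ν
          ≈⟨ *-congʳ (+-cong (trans (sym (sum-inner-𝟏 x)) (proj₁ x∈V)) (sum-constant (- x j))) ⟩
        (0# + N ×ℕ 1# * - x j) * ν
          ≈⟨ solve 3 (λ a b c → (con (0 , 0) :+ a :* b) :* c := a :* (b :* c)) refl
               (N ×ℕ 1#) (- x j) ν ⟩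
        N ×ℕ 1# * (- x j * ν)                      ≈⟨ N*ν-cancel (- x j) ⟩
        - x j                                      ∎

    -- Faces of the Voronoi cell.

    -- If every index is hit, all points `p ⊕ w o` lie in `F`; the `n` directions other than
    -- `w zero` are independent.
    dimension≥n : ∀ {m k} {p : Point N} {e : Fin m → Fin N} {F : Subset N} →
                  (∀ o → ∃ λ i → e i ≡ o) → F ≐ box p (w ∘ e) → HasDimension k F → n ≤ℕ k
    dimension≥n {p = p} {e} {F} e-hits (F⊆ , ⊆F) dim =
      dimension-lower {v = w ∘ suc} {F} dim (w-independent suc-injective (zero , λ _ ()))
        (⊆F (corner∈box p (w ∘ e))) vertex∈F
      where
      vertex∈F : ∀ l → p ⊕ w (suc l) ∈ F
      vertex∈F l with e-hits (suc l)
      ... | i , eᵢ≡1+l = ⊆F (≡.subst (λ o → p ⊕ w o ∈ box p (w ∘ e)) eᵢ≡1+l (vertex∈box p (w ∘ e) i))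

    -- A face using every `w i` would have dimension at least `n`, so below that some index is
    -- missed.
    face-isWBox : ∀ {k} {F : Subset N} → ¬ (n ≤ℕ k) →
                  IsFace F (VoronoiCell n) → HasDimension k F → WBox k F
    face-isWBox {k} {F} n≰k F-face dim@(x , _ , x∈ , _) = fromSubBox
      (face-of-box {p = 𝟎} {w} {F} {VoronoiCell n} (VoronoiCell⊆box , box⊆VoronoiCell) F-face (x , x∈))
      where
      fromSubBox : SubBox F w → WBox k F
      fromSubBox (m , p , e , e-injective , F≐) with any? (λ o → all? (λ i → ¬? (e i Fin.≟ o)))
      ... | yes e-misses = ≡.subst (λ m → WBox m F)
        (box-dimension {p = p} {w ∘ e} {F} (w-independent e-injective e-misses) F≐ dim)
        (p , e , e-injective , e-misses , F≐)
      ... | no ¬e-misses = contradiction (dimension≥n e-hits F≐ dim) n≰k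
        where
        e-hits : ∀ o → ∃ λ i → e i ≡ o
        e-hits o with any? (λ i → e i Fin.≟ o)
        ... | yes hit = hit
        ... | no ¬hit = contradiction (o , λ i eᵢ≡o → ¬hit (i , eᵢ≡o)) ¬e-misses

lemma6 : (ℝ : CompleteOrderedField) → let open Euclidean ℝ in
    ∀ (n k : ℕ) → 2 ≤ℕ k → k ≤ℕ n ∸ 1 →
    ∀ (F : Subset (suc n)) → IsFace F (VoronoiCell n) → HasDimension k F →
    IsHyperRhombus k F
lemma6 ℝ ℕ.zero 1 (s≤s ()) _
-- Truncated subtraction makes `0 ∸ 1` equal to 0, which leaves no `k` to consider.
lemma6 ℝ ℕ.zero (suc (suc k)) _ ()
lemma6 ℝ (suc n) 1 (s≤s ()) _
-- The bound `suc n ∸ 1` is `n`, so the dimension of the face is strictly below `suc n`, as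
-- `face-isWBox` requires.
lemma6 ℝ (suc n) (suc (suc k)) _ k≤n F F-face dim =
  wBox-isHyperRhombus k (face-isWBox (λ n<k → ℕ.<-irrefl ≡.refl (ℕ.≤-trans n<k k≤n)) F-face dim)
  where open Rhombohedra.Edges ℝ (suc n)
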